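{- For all pairs of integers $t\ge 3$ and $s\ge 1$ there exists a threshold $r_0=r_0(s,t)>s$ such that $$\chi_r(W(s,t))>t+2(r-1)$$ for every integer $r\ge r_0$.
   Context: Graphs are finite, simple and undirected. For positive integers $s,t$ the graph $W(s,t)$ has vertex set consisting of all sequences $(x_1,\dots,x_t)$ with $x_i\in\{0,1,\dots,s\}$ for all $i$, such that there is exactly one index $i$ with $x_i=0$ and at least one index $j$ with $x_j=1$. Two vertices $(x_1,\dots,x_t)$ and $(y_1,\dots,y_t)$ are adjacent if and only if for every $i$ either $|x_i-y_i|=1$ or $x_i=y_i=s$. For a graph $G$ and a positive integer $r$, the $r$-fold chromatic number ($r$-th multichromatic number) $\chi_r(G)$ is the minimum $n$ such that one can assign to each vertex of $G$ a set of exactly $r$ distinct colors from $\{1,\dots,n\}$ in such a way that adjacent vertices receive disjoint sets. (Equivalently, $G$ admits a homomorphism to the Kneser graph whose vertices are the $r$-element subsets of $\{1,\dots,n\}$, two being adjacent if and only if they are disjoint.) -}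

module Defs where

open import Data.Bool.Base using (Bool; true; false)
open import Data.Empty.Irrelevant using (⊥-elim)
open import Data.Fin.Base using (Fin; zero; suc; toℕ)
open import Data.Fin.Properties as Fin using (any?; all?)
open import Data.Fin.Subset using (Subset; ∣_∣; _∩_; ⁅_⁆; Empty)
open import Data.Fin.Subset.Properties
  using (nonempty?; ∣⁅x⁆∣≡1; x∈⁅y⁆⇒x≡y; x∈p∩q⁻; drop-∷-Empty)
open import Data.Irrelevant using ([_])
open import Data.List.Base as List using (List; []; _∷_; allFin; cartesianProductWith)
open import Data.List.Membership.Propositional using (lose) renaming (_∈_ to _∈ₗ_)
open import Data.List.Membership.Propositional.Properties
  using (∈-cartesianProductWith⁺; ∈-allFin)
import Data.List.Relation.Unary.All as All
open import Data.List.Relation.Unary.Any as Any using (here; there; index)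
open import Data.List.Relation.Unary.Any.Properties using (lookup-index)
open import Data.Nat.Base using (ℕ; zero; suc; _+_; _*_; _≤_; z≤n; s≤s; ∣_-_∣)
import Data.Nat.Properties as ℕ
open import Data.Product.Base using (∃; ∃-syntax; _×_; _,_; proj₁; proj₂)
open import Data.Product using (∃!)
open import Data.Refinement using (Refinement-syntax; value; _,_)
open import Data.Sum.Base as Sum using (_⊎_; inj₁; inj₂)
open import Data.Vec.Base as Vec using (Vec; []; _∷_; _++_; lookup; tabulate)
open import Data.Vec.Properties using (lookup∘tabulate; zipWith-++)
open import Function.Base using (_∘_)
open import Relation.Binary.PropositionalEquality
open import Relation.Nullary using (¬_; Dec; yes; no; contradiction; ¬?)
open import Relation.Nullary.Decidable using (map′; _×-dec_; _⊎-dec_; _→-dec_)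
open import Relation.Unary using (Decidable)

-- Finiteness is given by an enumeration, possibly with repetitions; equality of
-- vertices is then automatically decidable.
record Graph : Set₁ where
  infix 4 _~_
  field
    V        : Set
    vertices : List V
    complete : ∀ v → v ∈ₗ vertices
    _~_      : V → V → Set
    ~-sym    : ∀ {u v} → u ~ v → v ~ u
    ~-irrefl : ∀ {v} → ¬ v ~ v
    _~?_     : ∀ u v → Dec (u ~ v)

Disjoint : ∀ {n} → Subset n → Subset n → Set
Disjoint p q = Empty (p ∩ q)

module _ (G : Graph) where
  open Graph G

  IsColouring : (r n : ℕ) → (V → Subset n) → Set
  IsColouring r n c =
    (∀ v → ∣ c v ∣ ≡ r) × (∀ u v → u ~ v → Disjoint (c u) (c v))

  Colourable : (r n : ℕ) → Set
  Colourable r n = ∃[ c ] IsColouring r n c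

IsLeast : (ℕ → Set) → ℕ → Set
IsLeast P n = P n × (∀ {m} → P m → n ≤ m)

least : ∀ {P : ℕ → Set} → Decidable P → ∀ {n} → P n → ∃ (IsLeast P)
least {P} P? {n} p = go P? n p
  where
  go : ∀ {P : ℕ → Set} → Decidable P → ∀ n → P n → ∃ (IsLeast P)
  go P? zero p = zero , p , λ _ → z≤n
  go {P} P? (suc n) p with P? zero
  ... | yes p₀ = zero , p₀ , λ _ → z≤n
  ... | no ¬p₀ = let k , pk , min = go (P? ∘ suc) n p in
    suc k , pk , λ { {zero} p₀ → contradiction p₀ ¬p₀ ; {suc m} pm → s≤s (min pm) }

allVecs : ∀ {A : Set} → List A → ∀ k → List (Vec A k)
allVecs xs zero    = [] ∷ []
allVecs xs (suc k) = cartesianProductWith _∷_ xs (allVecs xs k)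

allVecs-complete : ∀ {A : Set} {xs : List A} → (∀ x → x ∈ₗ xs) →
                   ∀ {k} (v : Vec A k) → v ∈ₗ allVecs xs k
allVecs-complete c []      = here refl
allVecs-complete c (x ∷ v) =
  ∈-cartesianProductWith⁺ _∷_ (c x) (allVecs-complete c v)

private
  bools : List Bool
  bools = true ∷ false ∷ []

  bools-complete : ∀ b → b ∈ₗ bools
  bools-complete true  = here refl
  bools-complete false = there (here refl)

  block : ∀ r {k} → Fin k → Subset (r * k)
  block zero    i = []
  block (suc r) i = ⁅ i ⁆ ++ block r i

  ∣++∣ : ∀ {m n} (p : Subset m) (q : Subset n) → ∣ p ++ q ∣ ≡ ∣ p ∣ + ∣ q ∣
  ∣++∣ []          q = refl
  ∣++∣ (true ∷ p)  q = cong suc (∣++∣ p q)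
  ∣++∣ (false ∷ p) q = ∣++∣ p q

  ∣block∣ : ∀ r {k} (i : Fin k) → ∣ block r i ∣ ≡ r
  ∣block∣ zero    i = refl
  ∣block∣ (suc r) i =
    trans (∣++∣ ⁅ i ⁆ (block r i)) (cong₂ _+_ (∣⁅x⁆∣≡1 i) (∣block∣ r i))

  Empty-++ : ∀ {m n} (p : Subset m) {q : Subset n} →
             Empty p → Empty q → Empty (p ++ q)
  Empty-++ []          ep eq ne = eq ne
  Empty-++ (true ∷ p)  ep eq ne = ep (zero , Vec.here)
  Empty-++ (false ∷ p) ep eq (suc x , Vec.there x∈) =
    Empty-++ p (drop-∷-Empty ep) eq (x , x∈)

  block-disjoint : ∀ r {k} {i j : Fin k} → i ≢ j → Disjoint (block r i) (block r j)
  block-disjoint zero    i≢j (() , _)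
  block-disjoint (suc r) {i = i} {j} i≢j =
    subst Empty (sym (zipWith-++ _ ⁅ i ⁆ (block r i) ⁅ j ⁆ (block r j)))
      (Empty-++ (⁅ i ⁆ ∩ ⁅ j ⁆)
        (λ (x , x∈) → let x∈i , x∈j = x∈p∩q⁻ ⁅ i ⁆ ⁅ j ⁆ x∈ in
           i≢j (trans (sym (x∈⁅y⁆⇒x≡y i x∈i)) (x∈⁅y⁆⇒x≡y j x∈j)))
        (block-disjoint r i≢j))

module _ (G : Graph) where
  open Graph G

  allV? : ∀ {P : V → Set} → Decidable P → Dec (∀ v → P v)
  allV? P? = map′ (λ ps v → All.lookup ps (complete v)) (λ f → All.universal f vertices)
                  (All.all? P? vertices)

  isColouring? : ∀ r n → Decidable (IsColouring G r n)
  isColouring? r n c =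
    allV? (λ v → ∣ c v ∣ ℕ.≟ r) ×-dec
    allV? (λ u → allV? λ v → (u ~? v) →-dec ¬? (nonempty? (c u ∩ c v)))

  private
    pos : V → Fin (List.length vertices)
    pos v = index (complete v)

    lookup-pos : ∀ v → v ≡ List.lookup vertices (pos v)
    lookup-pos v = lookup-index (complete v)

    pos-injective : ∀ {u v} → pos u ≡ pos v → u ≡ v
    pos-injective {u} {v} eq =
      trans (lookup-pos u) (trans (cong (List.lookup vertices) eq) (sym (lookup-pos v)))

    respects : ∀ {r n} {c d : V → Subset n} → (∀ v → c v ≡ d v) →
               IsColouring G r n c → IsColouring G r n d
    respects c≗d (size , disj) =
      (λ v → trans (cong ∣_∣ (sym (c≗d v))) (size v)) ,
      (λ u v u~v → subst₂ Disjoint (c≗d u) (c≗d v) (disj u v u~v))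

  colourable? : ∀ r n → Dec (Colourable G r n)
  colourable? r n =
    map′ (λ a → let w , col = Any.satisfied a in (λ v → lookup w (pos v)) , col)
         (λ (c , col) → lose
           (allVecs-complete (allVecs-complete bools-complete)
             (tabulate (c ∘ List.lookup vertices)))
           (respects (λ v → trans (cong c (lookup-pos v))
                                  (sym (lookup∘tabulate _ (pos v)))) col))
         (Any.any? (λ w → isColouring? r n (λ v → lookup w (pos v)))
                   (allVecs (allVecs bools n) _))

  colourable : ∀ r → Colourable G r (r * List.length vertices)
  colourable r =
    block r ∘ pos ,
    ∣block∣ r ∘ pos ,
    λ u v u~v → block-disjoint r λ eq →
      ~-irrefl (subst (u ~_) (sym (pos-injective eq)) u~v)

χ-least : ∀ r G → ∃ (IsLeast (Colourable G r))
χ-least r G = least (colourable? G r) (colourable G r)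

χ : ℕ → Graph → ℕ
χ r G = proj₁ (χ-least r G)

χ-isLeast : ∀ r G → IsLeast (Colourable G r) (χ r G)
χ-isLeast r G = proj₂ (χ-least r G)

module _ (s t : ℕ) where

  Sequence : Set
  Sequence = Vec (Fin (suc s)) t

  infix 10 _‼_
  _‼_ : Sequence → Fin t → ℕ
  x ‼ i = toℕ (lookup x i)

  IsVertex : Sequence → Set
  IsVertex x = (∃! _≡_ λ i → x ‼ i ≡ 0) × (∃[ j ] x ‼ j ≡ 1)

  isVertex? : Decidable IsVertex
  isVertex? x =
    any? (λ i → (x ‼ i ℕ.≟ 0) ×-dec
      map′ (λ f {j} → f j) (λ f j → f {j})
           (all? λ j → (x ‼ j ℕ.≟ 0) →-dec (i Fin.≟ j)))
    ×-dec any? (λ j → x ‼ j ℕ.≟ 1)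

  -- The proof of IsVertex is irrelevant, so vertices are equal as soon as
  -- their sequences are.
  WVertex : Set
  WVertex = [ x ∈ Sequence ∣ IsVertex x ]

  WAdj : WVertex → WVertex → Set
  WAdj (x , _) (y , _) =
    ∀ i → ∣ x ‼ i - y ‼ i ∣ ≡ 1 ⊎ (x ‼ i ≡ s × y ‼ i ≡ s)

  private
    refineAll : List Sequence → List WVertex
    refineAll []       = []
    refineAll (x ∷ xs) with isVertex? x
    ... | yes p = (x , [ p ]) ∷ refineAll xs
    ... | no _  = refineAll xs

    ∈-refineAll : ∀ {xs} (v : WVertex) → value v ∈ₗ xs → v ∈ₗ refineAll xs
    ∈-refineAll {x ∷ xs} (.x , [ p ]) (here refl) with isVertex? x
    ... | yes _ = here refl
    ... | no ¬p = ⊥-elim (¬p p)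
    ∈-refineAll {x ∷ xs} v (there v∈) with isVertex? x
    ... | yes _ = there (∈-refineAll v v∈)
    ... | no _  = ∈-refineAll v v∈

    WAdj-sym : ∀ {u v} → WAdj u v → WAdj v u
    WAdj-sym {x , _} {y , _} a i =
      Sum.map (trans (ℕ.∣-∣-comm (y ‼ i) (x ‼ i))) (λ (p , q) → q , p) (a i)

    loopless : ∀ x → IsVertex x → ¬ (∀ i → ∣ x ‼ i - x ‼ i ∣ ≡ 1 ⊎ (x ‼ i ≡ s × x ‼ i ≡ s))
    loopless x ((i , xᵢ≡0 , _) , j , xⱼ≡1) a with a i
    ... | inj₁ eq = contradiction (trans (sym (ℕ.∣n-n∣≡0 (x ‼ i))) eq) λ ()
    ... | inj₂ (xᵢ≡s , _) = ℕ.n≮0 (ℕ.≤-trans 1≤s (ℕ.≤-reflexive (trans (sym xᵢ≡s) xᵢ≡0)))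
      where
      1≤s : 1 ≤ s
      1≤s = subst (_≤ s) xⱼ≡1 (Fin.toℕ≤pred[n] (lookup x j))

    WAdj-irrefl : ∀ {v} → ¬ WAdj v v
    WAdj-irrefl {x , [ p ]} a = ⊥-elim (loopless x p a)

    wAdj? : ∀ u v → Dec (WAdj u v)
    wAdj? (x , _) (y , _) = all? λ i →
      (∣ x ‼ i - y ‼ i ∣ ℕ.≟ 1) ⊎-dec ((x ‼ i ℕ.≟ s) ×-dec (y ‼ i ℕ.≟ s))

  W : Graph
  W = record
    { V        = WVertex
    ; vertices = refineAll (allVecs (allFin (suc s)) t)
    ; complete = λ v → ∈-refineAll v (allVecs-complete ∈-allFin (value v))
    ; _~_      = WAdj
    ; ~-sym    = λ {u} {v} → WAdj-sym {u} {v}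
    ; ~-irrefl = λ {v} → WAdj-irrefl {v}
    ; _~?_     = wAdj?
    }

{-# OPTIONS --safe #-}

-- If u, v, w, x carry r-subsets of n ≤ d + 2r colours, then a colour common to
-- u and x lies in v, in w, or in neither; hence the overlap of u and x is at
-- most the sum of the overlaps of the pairs uv, vw, wx, plus d. Along an odd
-- closed walk these bounds add up to a bound on r itself that depends only on
-- d and on the length of the walk, and W(s,t) has odd closed walks.

module Submission where

open import Defs
open import Data.Bool.Base using (Bool; true; false; _∧_)
open import Data.Fin.Base using (Fin; zero; suc; toℕ; fromℕ; inject₁)
open import Data.Fin.Induction using (>-weakInduction)
import Data.Fin.Properties as Fin
open import Data.Fin.Subset using (Subset; ∣_∣; _∩_)
open import Data.Fin.Subset.Properties using (∩-idem; Empty-unique; ∣⊥∣≡0)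
open import Data.Irrelevant using ([_])
open import Data.Nat.Base using (ℕ; suc; _+_; _*_; _∸_; _≤_; _≥_; _>_; z≤n; s≤s; ∣_-_∣)
open import Data.Nat.Properties
open import Data.Nat.Tactic.RingSolver using (solve-∀)
open import Data.Product.Base using (_×_; ∃-syntax; _,_; proj₁; proj₂)
open import Data.Refinement using (_,_; value-injective)
open import Data.Sum.Base using (_⊎_; inj₁; inj₂)
open import Data.Vec.Base using (Vec; []; _∷_; lookup; replicate; _[_]≔_)
open import Data.Vec.Properties
  using (lookup∘update; lookup∘update′; []≔-commutes)
open import Data.Vec.Relation.Binary.Pointwise.Inductive as Pointwise
  using (Pointwise; []; _∷_)
open import Data.Vec.Relation.Unary.All using (All; []; _∷_)
import Data.Vec.Relation.Unary.All.Properties as All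
open import Function.Base using (_∘_)
open import Relation.Binary.PropositionalEquality
open import Relation.Nullary using (yes; no; contradiction)

private
  bit : Bool → ℕ
  bit true  = 1
  bit false = 0

  ∣∷∣ : ∀ b {n} (p : Subset n) → ∣ b ∷ p ∣ ≡ bit b + ∣ p ∣
  ∣∷∣ true  p = refl
  ∣∷∣ false p = refl

  -- In all cases `bit b + bit c ≤ 1 + bit (b ∧ c)`. If `a` and `d` both hold, the terms for `a ∧ b`
  -- and `c ∧ d` already pay for `b` and `c`, and the 1 pays for `a ∧ d`.
  bit-overlap : ∀ a b c d →
    bit (a ∧ d) + (bit b + bit c) ≤
    1 + (bit (a ∧ b) + bit (b ∧ c) + bit (c ∧ d))
  bit-overlap false false false d     = z≤n
  bit-overlap false false true  d     = s≤s z≤n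
  bit-overlap false true  false d     = s≤s z≤n
  bit-overlap false true  true  d     = s≤s (s≤s z≤n)
  bit-overlap true  false false false = z≤n
  bit-overlap true  false false true  = s≤s z≤n
  bit-overlap true  false true  false = s≤s z≤n
  bit-overlap true  false true  true  = s≤s (s≤s z≤n)
  bit-overlap true  true  false false = s≤s z≤n
  bit-overlap true  true  false true  = s≤s (s≤s z≤n)
  bit-overlap true  true  true  false = s≤s (s≤s z≤n)
  bit-overlap true  true  true  true  = s≤s (s≤s (s≤s z≤n))

  +-interchange₃ : ∀ a a′ b b′ c c′ →
    (a + a′) + ((b + b′) + (c + c′)) ≡ (a + (b + c)) + (a′ + (b′ + c′))
  +-interchange₃ = solve-∀

  suc-+-interchange₃ : ∀ n a a′ b b′ c c′ →
    (1 + (a + b + c)) + (n + (a′ + b′ + c′)) ≡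
    suc n + ((a + a′) + (b + b′) + (c + c′))
  suc-+-interchange₃ = solve-∀

-- This is `bit-overlap` summed over the colours, with one 1 for each of the n colours.
∣∩∣-overlap : ∀ {n} (p q u v : Subset n) →
  ∣ p ∩ v ∣ + (∣ q ∣ + ∣ u ∣) ≤ n + (∣ p ∩ q ∣ + ∣ q ∩ u ∣ + ∣ u ∩ v ∣)
∣∩∣-overlap [] [] [] [] = z≤n
∣∩∣-overlap {suc n} (a ∷ p) (b ∷ q) (c ∷ u) (d ∷ v)
  rewrite ∣∷∣ (a ∧ d) (p ∩ v) | ∣∷∣ b q | ∣∷∣ c u
        | ∣∷∣ (a ∧ b) (p ∩ q) | ∣∷∣ (b ∧ c) (q ∩ u) | ∣∷∣ (c ∧ d) (u ∩ v) =
  subst₂ _≤_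
    (sym (+-interchange₃ (bit (a ∧ d)) (∣ p ∩ v ∣) (bit b) (∣ q ∣) (bit c) (∣ u ∣)))
    (suc-+-interchange₃ n (bit (a ∧ b)) (∣ p ∩ q ∣) (bit (b ∧ c)) (∣ q ∩ u ∣)
                          (bit (c ∧ d)) (∣ u ∩ v ∣))
    (+-mono-≤ (bit-overlap a b c d) (∣∩∣-overlap p q u v))

module Overlap (G : Graph) {r n d : ℕ} (n≤d+2r : n ≤ d + 2 * r)
               {c : Graph.V G → Subset n} (col : IsColouring G r n c) where
  open Graph G

  common : V → V → ℕ
  common u v = ∣ c u ∩ c v ∣

  common-self : ∀ v → common v v ≡ r
  common-self v = trans (cong ∣_∣ (∩-idem (c v))) (proj₁ col v)

  common-edge : ∀ {u v} → u ~ v → common u v ≤ 0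
  common-edge {u} {v} u~v =
    ≤-reflexive (trans (cong ∣_∣ (Empty-unique (proj₂ col u v u~v))) (∣⊥∣≡0 n))

  -- The two middle sets have r colours each, which cancels the 2r in n and leaves d. The three
  -- pairs need not be edges, so the bound can be iterated: an odd walk of 2m + 1 edges yields m *
  -- d.
  common-chain : ∀ {u v w x i j k} →
    common u v ≤ i → common v w ≤ j → common w x ≤ k →
    common u x ≤ d + (i + j + k)
  common-chain {u} {v} {w} {x} {i} {j} {k} uv vw wx =
    +-cancelʳ-≤ (r + r) _ _ (begin
      common u x + (r + r)
        ≡⟨ cong₂ (λ a b → common u x + (a + b)) (proj₁ col v) (proj₁ col w) ⟨
      common u x + (∣ c v ∣ + ∣ c w ∣)
        ≤⟨ ∣∩∣-overlap (c u) (c v) (c w) (c x) ⟩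
      n + (common u v + common v w + common w x)
        ≤⟨ +-mono-≤ n≤d+2r (+-mono-≤ (+-mono-≤ uv vw) wx) ⟩
      (d + 2 * r) + (i + j + k)
        ≡⟨ rearrange d r (i + j + k) ⟩
      (d + (i + j + k)) + (r + r) ∎)
    where
    open ≤-Reasoning
    rearrange : ∀ d r m → (d + 2 * r) + m ≡ (d + m) + (r + r)
    rearrange = solve-∀

module _ {A B : Set} {_∼_ : A → B → Set} {x : A} {y : B} (x∼y : x ∼ y) where

  pointwise-replicate : ∀ t → Pointwise _∼_ (replicate t x) (replicate t y)
  pointwise-replicate ℕ.zero  = []
  pointwise-replicate (suc t) = x∼y ∷ pointwise-replicate t

  pointwise-update : ∀ {t} {xs : Vec A t} {ys : Vec B t} → Pointwise _∼_ xs ys →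
                     ∀ i → Pointwise _∼_ (xs [ i ]≔ x) (ys [ i ]≔ y)
  pointwise-update (_ ∷ rs) zero    = x∼y ∷ rs
  pointwise-update (r ∷ rs) (suc i) = r ∷ pointwise-update rs i

module _ {A : Set} {P : A → Set} {x : A} (px : P x) where

  all-replicate : ∀ t → All P (replicate t x)
  all-replicate ℕ.zero  = []
  all-replicate (suc t) = px ∷ all-replicate t

  all-update : ∀ {t} {xs : Vec A t} → All P xs → ∀ i → All P (xs [ i ]≔ x)
  all-update (_ ∷ ps) zero    = px ∷ ps
  all-update (p ∷ ps) (suc i) = p ∷ all-update ps i

module Walk (s′ t : ℕ) where

  private
    s : ℕ
    s = suc s′

  open Graph (W s t)

  Close : Fin (suc s) → Fin (suc s) → Set
  Close a b = ∣ toℕ a - toℕ b ∣ ≡ 1 ⊎ (toℕ a ≡ s × toℕ b ≡ s)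

  -- k encodes the entry k + 1, so that 0 occurs at i only; if l is i or j, its
  -- entry is overwritten.
  sequence : Fin t → Fin t → Fin t → Fin s → Sequence s t
  sequence i j l k = ((replicate t (fromℕ s) [ l ]≔ suc k) [ j ]≔ suc zero) [ i ]≔ zero

  sequence-isVertex : ∀ {i j} → i ≢ j → ∀ l k → IsVertex s t (sequence i j l k)
  sequence-isVertex {i} {j} i≢j l k =
    (i , cong toℕ (lookup∘update i nonzeros zero) , unique) ,
    (j , cong toℕ (trans (lookup∘update′ (i≢j ∘ sym) nonzeros zero)
                         (lookup∘update j (replicate t (fromℕ s) [ l ]≔ suc k) (suc zero))))
    where
    nonzeros : Sequence s t
    nonzeros = (replicate t (fromℕ s) [ l ]≔ suc k) [ j ]≔ suc zero

    nonzeros≢0 : All (λ a → toℕ a ≢ 0) nonzeros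
    nonzeros≢0 =
      all-update 1+n≢0 (all-update 1+n≢0 (all-replicate 1+n≢0 t) l) j

    unique : ∀ {m} → toℕ (lookup (sequence i j l k) m) ≡ 0 → i ≡ m
    unique {m} eq with i Fin.≟ m
    ... | yes i≡m = i≡m
    ... | no  i≢m = contradiction
      (trans (sym (cong toℕ (lookup∘update′ (i≢m ∘ sym) nonzeros zero))) eq)
      (All.lookup⁺ nonzeros≢0 m)

  vertex : ∀ {i j} → i ≢ j → Fin t → Fin s → V
  vertex i≢j l k = sequence _ _ l k , [ sequence-isVertex i≢j l k ]

  -- At i and j the entries 0 and 1 trade places, at any other l `close` applies, and everywhere
  -- else s meets s.
  vertex-edge : ∀ {i j} (i≢j : i ≢ j) (j≢i : j ≢ i) l {k k′} → Close (suc k) (suc k′) →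
                vertex i≢j l k ~ vertex j≢i l k′
  vertex-edge {i} {j} i≢j j≢i l {k} {k′} close =
    -- The two sequences write their entries at i and j in opposite orders; reordering the left one
    -- lets the updates be compared one by one.
    Pointwise.lookup (subst (λ xs → Pointwise Close xs (sequence j i l k′))
      ([]≔-commutes _ i j i≢j)
      (pointwise-update (inj₁ refl)
        (pointwise-update (inj₁ refl)
          (pointwise-update close
            (pointwise-replicate (inj₂ (Fin.toℕ-fromℕ s , Fin.toℕ-fromℕ s)) t)
            l)
          i)
        j))

  -- The index `zero` encodes the entry 1, so j and l both carry a 1, and writes at distinct
  -- positions commute.
  vertex-relabel : ∀ {i j l} (i≢j : i ≢ j) (i≢l : i ≢ l) → j ≢ l →
                   vertex i≢j l zero ≡ vertex i≢l j zero
  vertex-relabel {i} {j} {l} i≢j i≢l j≢l =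
    value-injective (cong (_[ i ]≔ zero) ([]≔-commutes _ l j (j≢l ∘ sym)))

  module _ {r n d : ℕ} (n≤d+2r : n ≤ d + 2 * r)
           {c : V → Subset n} (col : IsColouring (W s t) r n c) where
    open Overlap (W s t) {d = d} n≤d+2r col

    -- The walk raises the entry at l to s while 0 and 1 alternate between i
    -- and j, repeats s once, and comes back: an odd number of steps.
    common-swap : ∀ k {i j} (i≢j : i ≢ j) (j≢i : j ≢ i) l →
      common (vertex i≢j l k) (vertex j≢i l k) ≤ (s′ ∸ toℕ k) * d
    common-swap = >-weakInduction
      (λ k → ∀ {i j} (i≢j : i ≢ j) (j≢i : j ≢ i) l →
        common (vertex i≢j l k) (vertex j≢i l k) ≤ (s′ ∸ toℕ k) * d)
      -- The top index encodes the entry s, which may be repeated along an edge, so here the swap is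
      -- a single edge.
      (λ i≢j j≢i l → ≤-trans
        (common-edge (vertex-edge i≢j j≢i l
          (inj₂ (Fin.toℕ-fromℕ s , Fin.toℕ-fromℕ s))))
        z≤n)
      λ k ih i≢j j≢i l → ≤-trans
        -- The first edge already exchanges 0 and 1, so the induction hypothesis is used with i and
        -- j reversed, and the last edge exchanges them again.
        (common-chain
          (common-edge (vertex-edge i≢j j≢i l (inj₁ (step k))))
          (ih j≢i i≢j l)
          (common-edge (vertex-edge i≢j j≢i l
            (inj₁ (trans (∣-∣-comm (toℕ (suc (suc k))) (toℕ (suc (inject₁ k)))) (step k))))))
        (≤-reflexive (count k))
      where
      step : ∀ (k : Fin s′) → ∣ toℕ (suc (inject₁ k)) - toℕ (suc (suc k)) ∣ ≡ 1
      step k = trans (cong (λ m → ∣ m - suc (toℕ k) ∣) (Fin.toℕ-inject₁ k)) (∣n-1+n∣ (toℕ k))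
        where
        ∣n-1+n∣ : ∀ m → ∣ m - suc m ∣ ≡ 1
        ∣n-1+n∣ m = trans (cong (∣ m -_∣) (+-comm 1 m)) (∣m-m+n∣≡n m 1)

      count : ∀ k → d + (0 + (s′ ∸ suc (toℕ k)) * d + 0) ≡ (s′ ∸ toℕ (inject₁ k)) * d
      count k = begin
        d + ((s′ ∸ suc (toℕ k)) * d + 0)  ≡⟨ cong (d +_) (+-identityʳ _) ⟩
        suc (s′ ∸ suc (toℕ k)) * d        ≡⟨ cong (_* d) (suc[m]∸n k) ⟩
        (s′ ∸ toℕ (inject₁ k)) * d        ∎
        where
        open ≡-Reasoning
        suc[m]∸n : ∀ (k : Fin s′) → suc (s′ ∸ suc (toℕ k)) ≡ s′ ∸ toℕ (inject₁ k)
        suc[m]∸n k = trans (sym (+-∸-assoc 1 (Fin.toℕ<n k)))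
                           (cong (s′ ∸_) (sym (Fin.toℕ-inject₁ k)))

    -- The swap leads to the sequence with 0 at j and 1 at both i and l, in
    -- which i and l play the same role.
    common-rotate : ∀ {i j l} (i≢j : i ≢ j) (j≢l : j ≢ l) → l ≢ i →
      common (vertex i≢j l zero) (vertex j≢l i zero) ≤ s′ * d
    common-rotate {l = l} i≢j j≢l l≢i =
      subst (λ v → common (vertex i≢j l zero) v ≤ s′ * d)
        (vertex-relabel (i≢j ∘ sym) j≢l (l≢i ∘ sym))
        (common-swap zero i≢j (i≢j ∘ sym) l)

    -- Three rotations of (i, j, l) return to the starting vertex, and three odd walks make an odd
    -- closed walk; a vertex shares all r colours with itself. This is where three positions are
    -- required.
    fold-bound : ∀ {i j l : Fin t} → i ≢ j → j ≢ l → l ≢ i →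
      r ≤ d + (s′ * d + s′ * d + s′ * d)
    fold-bound {l = l} i≢j j≢l l≢i = subst (_≤ _) (common-self (vertex i≢j l zero))
      (common-chain (common-rotate i≢j j≢l l≢i)
                    (common-rotate j≢l l≢i i≢j)
                    (common-rotate l≢i i≢j j≢l))

proposition6 : (s t : ℕ) → t ≥ 3 → s ≥ 1 →
    ∃[ r₀ ] (r₀ > s × ((r : ℕ) → r ≥ r₀ → χ r (W s t) > t + 2 * (r ∸ 1)))
proposition6 s@(suc s′) t@(suc (suc (suc _))) (s≤s (s≤s (s≤s _))) _ =
  -- The summand s secures `r₀ > s`, while b is the bound of `fold-bound` for d = t.
  suc (s + b) , s≤s (m≤m+n s b) , λ r r≥r₀ → ≰⇒> λ χ≤ →
    <⇒≱ (≤-trans (s≤s (m≤n+m b s)) r≥r₀) (bound r χ≤)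
  where
  b : ℕ
  b = t + (s′ * t + s′ * t + s′ * t)

  bound : ∀ r → χ r (W s t) ≤ t + 2 * (r ∸ 1) → r ≤ b
  bound r χ≤ =
    let c , col = proj₁ (χ-isLeast r (W s t)) in
    -- Weakening `r ∸ 1` to r brings the number of colours into the form d + 2r with d = t; this
    -- costs only the size of the threshold.
    Walk.fold-bound s′ t {d = t} (≤-trans χ≤ (+-monoʳ-≤ t (*-monoʳ-≤ 2 (m∸n≤m r 1)))) {c} col
      {zero} {suc zero} {suc (suc zero)} (λ ()) (λ ()) (λ ())
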